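{- Let $\langle A,\to\rangle$ be a conditional algebra, and for $U,V\subseteq\mathrm{Ul}(A)$ define $$U\to^{\sigma}V=\bigcup_{(O,Y)}\ \bigcap_{\substack{a,b\in A\\ \varphi(a)\subseteq O,\ Y\subseteq\varphi(b)}}\varphi(a\to b),$$ where $(O,Y)$ ranges over pairs with $O$ an open subset of the Stone space of $A$ with $U\subseteq O$ and $Y$ a closed subset with $Y\subseteq V$. Then $\langle\mathcal{P}(\mathrm{Ul}(A)),\to^{\sigma}\rangle$ is a conditional algebra.
   Context: A conditional algebra is a pair $\langle A,\to\rangle$ where $A$ is a Boolean algebra and $\to$ is a binary operation on $A$ such that for all $a,b,c$: $a\to 1=1$; $(a\to b)\wedge(a\to c)=a\to(b\wedge c)$; $(a\vee b)\to c\le (a\to c)\wedge(b\to c)$. $\mathrm{Ul}(A)$ is the set of ultrafilters of $A$ with the Stone topology (basic clopens $\varphi(a)=\{u:a\in u\}$). The operation $\to^\sigma$ is the $\sigma$-extension of $\to$ (viewed as antitone in the first and isotone in the second argument). -}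

module Defs where

open import Algebra.Core using (Op₁; Op₂)
open import Algebra.Definitions using (Congruent₂)
open import Algebra.Lattice.Bundles using (BooleanAlgebra)
open import Algebra.Lattice.Structures using (IsBooleanAlgebra)
open import Data.Product using (∃; ∃₂; _×_; _,_; proj₁; proj₂)
open import Data.Sum using (_⊎_; inj₁; inj₂)
open import Level using (Level; _⊔_; suc)
open import Relation.Binary.Bundles using (Poset)
open import Relation.Binary.Core using (Rel)
open import Relation.Binary.Definitions using (_Respects_)
open import Relation.Unary using (Pred; _∈_; _∉_; _⊆_; _≐_; _∪_; _∩_; ∁)
import Relation.Binary.Construct.NaturalOrder.Left as NaturalOrder
import Data.Empty.Polymorphic as Empty
import Data.Unit.Polymorphic as Unit

-- The choice principle of the classical metatheory, for posets whose equality
-- is a setoid equality; excluded middle is assumed separately.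
ZornsLemma : ∀ a ℓ₁ ℓ₂ → Set (suc (a ⊔ ℓ₁ ⊔ ℓ₂))
ZornsLemma a ℓ₁ ℓ₂ =
  (P : Poset a ℓ₁ ℓ₂) → let open Poset P in
  (∀ (C : Pred Carrier a) →
     (∀ {x y} → x ∈ C → y ∈ C → x ≤ y ⊎ y ≤ x) →
     ∃ λ z → ∀ {x} → x ∈ C → x ≤ z) →
  ∃ λ m → ∀ {x} → m ≤ x → x ≤ m

record IsConditionalAlgebra {c ℓ} {A : Set c} (_≈_ : Rel A ℓ)
                            (_∨_ _∧_ : Op₂ A) (¬_ : Op₁ A) (⊤ ⊥ : A)
                            (_⇒_ : Op₂ A) : Set (c ⊔ ℓ) where
  open NaturalOrder _≈_ _∧_ using (_≤_)
  field
    isBooleanAlgebra : IsBooleanAlgebra _≈_ _∨_ _∧_ ¬_ ⊤ ⊥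
    ⇒-cong           : Congruent₂ _≈_ _⇒_
    ⇒-⊤              : ∀ a → (a ⇒ ⊤) ≈ ⊤
    ⇒-∧              : ∀ a b c → ((a ⇒ b) ∧ (a ⇒ c)) ≈ (a ⇒ (b ∧ c))
    ∨-⇒              : ∀ a b c → ((a ∨ b) ⇒ c) ≤ ((a ⇒ c) ∧ (b ⇒ c))

record ConditionalAlgebra c ℓ : Set (suc (c ⊔ ℓ)) where
  field
    Carrier              : Set c
    _≈_                  : Rel Carrier ℓ
    _∨_                  : Op₂ Carrier
    _∧_                  : Op₂ Carrier
    ¬_                   : Op₁ Carrier
    ⊤                    : Carrier
    ⊥                    : Carrier
    _⇒_                  : Op₂ Carrier
    isConditionalAlgebra : IsConditionalAlgebra _≈_ _∨_ _∧_ ¬_ ⊤ ⊥ _⇒_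

  open IsConditionalAlgebra isConditionalAlgebra public

  booleanAlgebra : BooleanAlgebra c ℓ
  booleanAlgebra = record { isBooleanAlgebra = isBooleanAlgebra }

module StoneSpace {c ℓ} (B : BooleanAlgebra c ℓ) where
  open BooleanAlgebra B using (Carrier; _≈_; _∧_; ⊤; ⊥)
  open NaturalOrder _≈_ _∧_ using (_≤_)

  record IsProperFilter (F : Pred Carrier (c ⊔ ℓ)) : Set (c ⊔ ℓ) where
    field
      ⊤-mem    : ⊤ ∈ F
      ∧-closed : ∀ {x y} → x ∈ F → y ∈ F → (x ∧ y) ∈ F
      ≤-closed : ∀ {x y} → x ≤ y → x ∈ F → y ∈ F
      proper   : ⊥ ∉ F

  record Ultrafilter : Set (suc (c ⊔ ℓ)) where
    field
      mem            : Pred Carrier (c ⊔ ℓ)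
      isProperFilter : IsProperFilter mem
      maximal        : ∀ (G : Pred Carrier (c ⊔ ℓ)) → IsProperFilter G →
                       mem ⊆ G → G ⊆ mem

  open Ultrafilter public using (mem)

  _≈ᵁ_ : Rel Ultrafilter (c ⊔ ℓ)
  u ≈ᵁ v = mem u ≐ mem v

  -- Ultrafilters with the same elements are not propositionally equal
  -- without extensionality, so subsets must respect _≈ᵁ_ explicitly.
  record Subset (s : Level) : Set (suc (c ⊔ ℓ ⊔ s)) where
    field
      pts      : Pred Ultrafilter s
      respects : pts Respects _≈ᵁ_

  open Subset public using (pts)

  φ : Carrier → Subset (c ⊔ ℓ)
  φ a = record { pts = λ u → a ∈ mem u ; respects = λ u≈v → proj₁ u≈v }

  IsOpen : ∀ {s} → Subset s → Set (suc (c ⊔ ℓ) ⊔ s)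
  IsOpen O = ∀ u → u ∈ pts O → ∃ λ a → u ∈ pts (φ a) × pts (φ a) ⊆ pts O

  complement : ∀ {s} → Subset s → Subset s
  complement X = record
    { pts      = ∁ (pts X)
    ; respects = λ { (u⊆v , v⊆u) u∉X v∈X →
                     u∉X (Subset.respects X (v⊆u , u⊆v) v∈X) }
    }

  IsClosed : ∀ {s} → Subset s → Set (suc (c ⊔ ℓ) ⊔ s)
  IsClosed Y = IsOpen (complement Y)

  -- 𝒫(Ul(B)).  The level is the least one closed under the σ-extension below,
  -- which quantifies over open and closed sets of level c ⊔ ℓ.  Under excluded
  -- middle every subset is extensionally equal to one of level c ⊔ ℓ, so the
  -- levels impose no restriction on the subsets considered.
  Powerset : Set (suc (suc (c ⊔ ℓ)))
  Powerset = Subset (suc (c ⊔ ℓ))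

  _≈ᴾ_ : Rel Powerset (suc (c ⊔ ℓ))
  X ≈ᴾ Y = pts X ≐ pts Y

  _∪ᴾ_ : Op₂ Powerset
  X ∪ᴾ Y = record
    { pts      = pts X ∪ pts Y
    ; respects = λ { u≈v (inj₁ p) → inj₁ (Subset.respects X u≈v p)
                   ; u≈v (inj₂ q) → inj₂ (Subset.respects Y u≈v q) }
    }

  _∩ᴾ_ : Op₂ Powerset
  X ∩ᴾ Y = record
    { pts      = pts X ∩ pts Y
    ; respects = λ { u≈v (p , q) → Subset.respects X u≈v p ,
                                   Subset.respects Y u≈v q }
    }

  ∁ᴾ : Op₁ Powerset
  ∁ᴾ = complement

  fullᴾ : Powerset
  fullᴾ = record { pts = λ _ → Unit.⊤ ; respects = λ _ p → p }

  emptyᴾ : Powerset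
  emptyᴾ = record { pts = λ _ → Empty.⊥ ; respects = λ _ p → p }

module SigmaExtension {c ℓ} (A : ConditionalAlgebra c ℓ) where
  open ConditionalAlgebra A using (Carrier; _⇒_; booleanAlgebra)
  open StoneSpace booleanAlgebra public

  _⇒σ_ : Op₂ Powerset
  U ⇒σ V = record
    { pts      = λ u → ∃₂ λ (O Y : Subset (c ⊔ ℓ)) →
                   (IsOpen O × pts U ⊆ pts O) ×
                   (IsClosed Y × pts Y ⊆ pts V) ×
                   (∀ (a b : Carrier) → pts (φ a) ⊆ pts O → pts Y ⊆ pts (φ b) →
                      u ∈ pts (φ (a ⇒ b)))
    ; respects = λ { (u⊆v , _) (O , Y , hO , hY , h) →
                     O , Y , hO , hY , λ a b p q → u⊆v (h a b p q) }
    }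

{-# OPTIONS --safe #-}
-- The only law of conditional algebras that does not follow at once from the
-- definition of U →σ V is (U →σ V) ∩ (U →σ W) ⊆ U →σ (V ∩ W).  If (O₁ , Y₁) and
-- (O₂ , Y₂) witness membership in the two sets on the left, then
-- (O₁ ∩ O₂ , Y₁ ∩ Y₂) is a witness for the right: by compactness of the Stone
-- space, Y₁ ∩ Y₂ ⊆ φ(b) yields b₁, b₂ with Yᵢ ⊆ φ(bᵢ) and b₁ ∧ b₂ ≤ b, and then
-- (a → b₁) ∧ (a → b₂) = a → (b₁ ∧ b₂) ≤ a → b.  Compactness is obtained from the
-- ultrafilter theorem, applied to the filter generated by the elements whose
-- clopens contain Y₁ or Y₂.
module Submission where

open import Defs
open import Algebra.Lattice.Bundles using (BooleanAlgebra)
open import Algebra.Lattice.Structures using (IsBooleanAlgebra; IsDistributiveLattice)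
open import Algebra.Lattice.Structures.Biased using (isBooleanAlgebraʳ)
open import Axiom.ExcludedMiddle using (ExcludedMiddle)
open import Data.Empty using (⊥-elim)
open import Data.Product using (∃; ∃₂; _×_; _,_; proj₁; proj₂)
open import Data.Sum using (_⊎_; inj₁; inj₂)
open import Data.Unit.Polymorphic using (tt)
open import Function using (id; _∘_)
open import Level using (Level; _⊔_; suc; Lift; lift; lower)
open import Relation.Binary.Bundles using (Poset)
open import Relation.Nullary.Decidable using (True; toWitness; fromWitness; map′; decidable-stable; toSum)
open import Relation.Unary using (Pred; _∈_; _∉_; _⊆_; _≐_; _∩_)
open import Relation.Unary.Properties using (≐-refl; ≐-sym; ≐-trans)
import Algebra.Lattice.Properties.BooleanAlgebra as BooleanAlgebraProperties
import Relation.Binary.Lattice as OrderTheory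
import Relation.Binary.Reasoning.Setoid as SetoidReasoning
import Relation.Unary.Algebra as UnaryAlgebra

-- Excluded middle across universe levels.

lowerExcludedMiddle : ∀ {s} → ExcludedMiddle (suc s) → ExcludedMiddle s
lowerExcludedMiddle {s} em = map′ lower lift (em {Lift (suc s) _})

-- Excluded middle gives propositional resizing: the union of a chain of filters
-- and the filter of a set of points quantify one universe too high.
module Resizing {s} (em : ExcludedMiddle (suc s)) where

  Resize : Set (suc s) → Set s
  Resize P = Lift s (True (em {P}))

  resize : ∀ {P} → P → Resize P
  resize p = lift (fromWitness p)

  unresize : ∀ {P} → Resize P → P
  unresize r = toWitness (lower r)

-- The natural order of a Boolean algebra.

module BooleanOrder {c ℓ} (B : BooleanAlgebra c ℓ) where
  open BooleanAlgebra B
  open BooleanAlgebraProperties B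
    using (∧-identityʳ; ∨-identityʳ; ∧-orderTheoreticMeetSemilattice)
  open OrderTheory.MeetSemilattice ∧-orderTheoreticMeetSemilattice public
    using (_≤_; x∧y≤x; x∧y≤y; ∧-greatest)
    renaming (refl to ≤-refl; trans to ≤-trans; reflexive to ≤-reflexive; antisym to ≤-antisym)
  open SetoidReasoning setoid

  ∧-mono : ∀ {x x′ y y′} → x ≤ x′ → y ≤ y′ → (x ∧ y) ≤ (x′ ∧ y′)
  ∧-mono p q = ∧-greatest (≤-trans (x∧y≤x _ _) p) (≤-trans (x∧y≤y _ _) q)

  x≤⊤ : ∀ x → x ≤ ⊤
  x≤⊤ x = sym (∧-identityʳ x)

  ⊥≤x : ∀ x → ⊥ ≤ x
  ⊥≤x x = ≤-trans (≤-reflexive (sym (∧-complementʳ x))) (x∧y≤x _ _)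

  -- Splitting `x` along `y` and `¬ y` leaves only `x ∧ y`. The chain may stop there because `x ≤ y`
  -- is by definition the equation `x ≈ x ∧ y`.
  x∧¬y≤⊥⇒x≤y : ∀ {x y} → (x ∧ ¬ y) ≤ ⊥ → x ≤ y
  x∧¬y≤⊥⇒x≤y {x} {y} x∧¬y≤⊥ = begin
    x                     ≈⟨ ∧-identityʳ x ⟨
    x ∧ ⊤                 ≈⟨ ∧-congˡ (∨-complementʳ y) ⟨
    x ∧ (y ∨ ¬ y)         ≈⟨ ∧-distribˡ-∨ x y (¬ y) ⟩
    (x ∧ y) ∨ (x ∧ ¬ y)   ≈⟨ ∨-congˡ (≤-antisym x∧¬y≤⊥ (⊥≤x _)) ⟩
    (x ∧ y) ∨ ⊥           ≈⟨ ∨-identityʳ (x ∧ y) ⟩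
    x ∧ y                 ∎

-- Filters and ultrafilters.

module Filters {c ℓ} (B : BooleanAlgebra c ℓ) where
  open BooleanAlgebra B using (Carrier; _∧_; ¬_; ⊤; ⊥; ∧-complementʳ)
  open BooleanOrder B
  open StoneSpace B

  record IsFilter (F : Pred Carrier (c ⊔ ℓ)) : Set (c ⊔ ℓ) where
    field
      ⊤-mem    : ⊤ ∈ F
      ∧-closed : ∀ {x y} → x ∈ F → y ∈ F → (x ∧ y) ∈ F
      ≤-closed : ∀ {x y} → x ≤ y → x ∈ F → y ∈ F

  module _ {F : Pred Carrier (c ⊔ ℓ)} where

    properFilter : IsFilter F → ⊥ ∉ F → IsProperFilter F
    properFilter filF ⊥∉F = record { IsFilter filF ; proper = ⊥∉F }

    isFilter : IsProperFilter F → IsFilter F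
    isFilter propF = record { IsProperFilter propF }

  principal : Carrier → Pred Carrier (c ⊔ ℓ)
  principal a x = Lift (c ⊔ ℓ) (a ≤ x)

  principal-isFilter : ∀ a → IsFilter (principal a)
  principal-isFilter a = record
    { ⊤-mem    = lift (x≤⊤ a)
    ; ∧-closed = λ (lift p) (lift q) → lift (∧-greatest p q)
    ; ≤-closed = λ x≤y (lift p) → lift (≤-trans p x≤y)
    }

  infixl 6 _⊕_

  -- For filters `F` and `G` this is their join, the filter generated by the union.
  _⊕_ : (F G : Pred Carrier (c ⊔ ℓ)) → Pred Carrier (c ⊔ ℓ)
  (F ⊕ G) x = ∃₂ λ y z → y ∈ F × z ∈ G × (y ∧ z) ≤ x

  module _ {F G : Pred Carrier (c ⊔ ℓ)} (filF : IsFilter F) (filG : IsFilter G) where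
    private
      module F = IsFilter filF
      module G = IsFilter filG

    ⊕-isFilter : IsFilter (F ⊕ G)
    ⊕-isFilter = record
      { ⊤-mem    = ⊤ , ⊤ , F.⊤-mem , G.⊤-mem , x≤⊤ _
      ; ∧-closed = λ (y , z , y∈F , z∈G , p) (y′ , z′ , y′∈F , z′∈G , p′) →
          y ∧ y′ , z ∧ z′ , F.∧-closed y∈F y′∈F , G.∧-closed z∈G z′∈G ,
          ∧-greatest (≤-trans (∧-mono (x∧y≤x _ _) (x∧y≤x _ _)) p)
                     (≤-trans (∧-mono (x∧y≤y _ _) (x∧y≤y _ _)) p′)
      ; ≤-closed = λ x≤x′ (y , z , y∈F , z∈G , p) → y , z , y∈F , z∈G , ≤-trans p x≤x′
      }

    ⊕-upperˡ : F ⊆ F ⊕ G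
    ⊕-upperˡ x∈F = _ , ⊤ , x∈F , G.⊤-mem , x∧y≤x _ _

    ⊕-upperʳ : G ⊆ F ⊕ G
    ⊕-upperʳ x∈G = ⊤ , _ , F.⊤-mem , x∈G , x∧y≤y _ _

  module _ {F : Pred Carrier (c ⊔ ℓ)} (filF : IsFilter F) (a : Carrier) (a∉F : a ∉ F) where

    -- If `⊥` were generated, some `y` in `F` would satisfy `y ∧ ¬ a ≤ ⊥`, that is `y ≤ a`, which
    -- would put `a` into `F`.
    adjoin-¬-isProperFilter : IsProperFilter (F ⊕ principal (¬ a))
    adjoin-¬-isProperFilter =
      properFilter (⊕-isFilter filF (principal-isFilter (¬ a)))
        λ (y , z , y∈F , lift ¬a≤z , y∧z≤⊥) →
          a∉F (IsFilter.≤-closed filF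
                 (x∧¬y≤⊥⇒x≤y (≤-trans (∧-mono ≤-refl ¬a≤z) y∧z≤⊥)) y∈F)

    ¬-mem-adjoin : (¬ a) ∈ F ⊕ principal (¬ a)
    ¬-mem-adjoin = ⊕-upperʳ filF (principal-isFilter (¬ a)) (lift ≤-refl)

  module Mem (u : Ultrafilter) = IsProperFilter (Ultrafilter.isProperFilter u)

  module _ (u : Ultrafilter) where

    -- Adjoining `¬ a` to `u` keeps it proper, so by maximality nothing new was adjoined.
    ∉⇒¬∈ : ∀ {a} → a ∉ mem u → (¬ a) ∈ mem u
    ∉⇒¬∈ {a} a∉u =
      Ultrafilter.maximal u _ (adjoin-¬-isProperFilter fil a a∉u)
        (⊕-upperˡ fil (principal-isFilter (¬ a))) (¬-mem-adjoin fil a a∉u)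
      where fil = isFilter (Ultrafilter.isProperFilter u)

    ¬∈⇒∉ : ∀ {a} → (¬ a) ∈ mem u → a ∉ mem u
    ¬∈⇒∉ ¬a∈u a∈u =
      Mem.proper u (Mem.≤-closed u (≤-reflexive (∧-complementʳ _)) (Mem.∧-closed u a∈u ¬a∈u))

-- The ultrafilter theorem.

module UltrafilterTheorem {c ℓ} (B : BooleanAlgebra c ℓ)
                          (em : ExcludedMiddle (suc (c ⊔ ℓ)))
                          (zorn : ZornsLemma (suc (c ⊔ ℓ)) (c ⊔ ℓ) (c ⊔ ℓ)) where
  open BooleanAlgebra B using (Carrier; _∧_; ¬_; ⊤; ⊥)
  open BooleanOrder B
  open StoneSpace B
  open Filters B
  open Resizing em

  module _ {G : Pred Carrier (c ⊔ ℓ)} (propG : IsProperFilter G) where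
    private
      module G = IsProperFilter propG

      Extension : Set (suc (c ⊔ ℓ))
      Extension = ∃ λ F → IsProperFilter F × G ⊆ F

      extensions : Poset (suc (c ⊔ ℓ)) (c ⊔ ℓ) (c ⊔ ℓ)
      extensions = record
        { Carrier        = Extension
        ; _≈_            = λ E E′ → proj₁ E ≐ proj₁ E′
        ; _≤_            = λ E E′ → proj₁ E ⊆ proj₁ E′
        ; isPartialOrder = record
          { isPreorder = record
            { isEquivalence = record { refl = ≐-refl ; sym = ≐-sym ; trans = ≐-trans }
            ; reflexive     = proj₁
            ; trans         = λ p q → q ∘ p
            }
          ; antisym    = _,_
          }
        }

      module _ (C : Pred Extension (suc (c ⊔ ℓ)))
               (chain : ∀ {E E′} → E ∈ C → E′ ∈ C → proj₁ E ⊆ proj₁ E′ ⊎ proj₁ E′ ⊆ proj₁ E)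
               where

        -- G is included so that the empty chain also has an upper bound.
        ⋃C : Pred Carrier (c ⊔ ℓ)
        ⋃C x = x ∈ G ⊎ Resize (∃ λ E → E ∈ C × x ∈ proj₁ E)

        mem-⋃ : ∀ E → E ∈ C → proj₁ E ⊆ ⋃C
        mem-⋃ E E∈C x∈E = inj₂ (resize (E , E∈C , x∈E))

        ⋃-∧-closed : ∀ {x y} → x ∈ ⋃C → y ∈ ⋃C → (x ∧ y) ∈ ⋃C
        ⋃-∧-closed (inj₁ x∈G) (inj₁ y∈G) = inj₁ (G.∧-closed x∈G y∈G)
        ⋃-∧-closed (inj₁ x∈G) (inj₂ r) with unresize r
        ... | E@(_ , propE , G⊆E) , E∈C , y∈E =
          mem-⋃ E E∈C (IsProperFilter.∧-closed propE (G⊆E x∈G) y∈E)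
        ⋃-∧-closed (inj₂ r) (inj₁ y∈G) with unresize r
        ... | E@(_ , propE , G⊆E) , E∈C , x∈E =
          mem-⋃ E E∈C (IsProperFilter.∧-closed propE x∈E (G⊆E y∈G))
        -- Of the two chain members involved, the larger contains both `x` and `y`.
        ⋃-∧-closed (inj₂ r) (inj₂ r′) with unresize r | unresize r′
        ... | E@(_ , propE , _) , E∈C , x∈E | E′@(_ , propE′ , _) , E′∈C , y∈E′
            with chain {E} {E′} E∈C E′∈C
        ...   | inj₁ E⊆E′ = mem-⋃ E′ E′∈C (IsProperFilter.∧-closed propE′ (E⊆E′ x∈E) y∈E′)
        ...   | inj₂ E′⊆E = mem-⋃ E E∈C (IsProperFilter.∧-closed propE x∈E (E′⊆E y∈E′))

        ⋃-≤-closed : ∀ {x y} → x ≤ y → x ∈ ⋃C → y ∈ ⋃C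
        ⋃-≤-closed x≤y (inj₁ x∈G) = inj₁ (G.≤-closed x≤y x∈G)
        ⋃-≤-closed x≤y (inj₂ r) with unresize r
        ... | E@(_ , propE , _) , E∈C , x∈E =
          mem-⋃ E E∈C (IsProperFilter.≤-closed propE x≤y x∈E)

        ⋃-proper : ⊥ ∉ ⋃C
        ⋃-proper (inj₁ ⊥∈G) = G.proper ⊥∈G
        ⋃-proper (inj₂ r) with unresize r
        ... | (_ , propE , _) , _ , ⊥∈E = IsProperFilter.proper propE ⊥∈E

        ⋃-extension : Extension
        ⋃-extension = ⋃C , record
          { ⊤-mem    = inj₁ G.⊤-mem
          ; ∧-closed = ⋃-∧-closed
          ; ≤-closed = ⋃-≤-closed
          ; proper   = ⋃-proper
          } , inj₁

    extendToUltrafilter : ∃ λ u → G ⊆ mem u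
    extendToUltrafilter
      with zorn extensions (λ C chain →
             ⋃-extension C (λ {E} {E′} → chain {E} {E′}) ,
             λ {E} → mem-⋃ C (λ {E} {E′} → chain {E} {E′}) E)
    ... | (M , propM , G⊆M) , M-max = record
      { mem            = M
      ; isProperFilter = propM
      -- Zorn's lemma gives maximality among extensions of `G` only, but a proper filter containing
      -- `M` also contains `G`.
      ; maximal        = λ H propH M⊆H → M-max {H , propH , M⊆H ∘ G⊆M} M⊆H
      } , G⊆M

  separate : ∀ {F} → IsFilter F → ∀ {a} → a ∉ F → ∃ λ u → F ⊆ mem u × a ∉ mem u
  separate filF {a} a∉F with extendToUltrafilter (adjoin-¬-isProperFilter filF a a∉F)
  ... | u , F⊕¬a⊆u =
    u , F⊕¬a⊆u ∘ ⊕-upperˡ filF (principal-isFilter (¬ a)) ,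
    ¬∈⇒∉ u (F⊕¬a⊆u (¬-mem-adjoin filF a a∉F))

  -- A filter is the intersection of the ultrafilters extending it: an element outside is missed by
  -- the ultrafilter that `separate` provides.
  ∈-allExtensions⇒∈ : ∀ {F} → IsFilter F → ∀ {a} → (∀ u → F ⊆ mem u → a ∈ mem u) → a ∈ F
  ∈-allExtensions⇒∈ filF all = decidable-stable (lowerExcludedMiddle em) λ a∉F →
    let u , F⊆u , a∉u = separate filF a∉F in a∉u (all u F⊆u)

  ⊤≤ : ∀ {a} → (∀ u → a ∈ mem u) → ⊤ ≤ a
  ⊤≤ all = lower (∈-allExtensions⇒∈ (principal-isFilter ⊤) λ u _ → all u)

  -- Closed sets of the Stone space, their filters, and compactness.

  filterOf : Subset (c ⊔ ℓ) → Pred Carrier (c ⊔ ℓ)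
  filterOf Y x = Resize (pts Y ⊆ pts (φ x))

  filterOf-isFilter : ∀ Y → IsFilter (filterOf Y)
  filterOf-isFilter Y = record
    { ⊤-mem    = resize λ {u} _ → Mem.⊤-mem u
    ; ∧-closed = λ p q → resize λ {u} u∈Y → Mem.∧-closed u (unresize p u∈Y) (unresize q u∈Y)
    ; ≤-closed = λ x≤y p → resize λ {u} u∈Y → Mem.≤-closed u x≤y (unresize p u∈Y)
    }

  -- A point `u` outside `Y` has a neighbourhood `φ a` disjoint from `Y`. Then `Y` lies inside
  -- `φ (¬ a)`, so `¬ a` is in the filter of `Y` and hence in `u`, against `a ∈ mem u`.
  filterOf⊆⇒∈ : ∀ {Y} → IsClosed Y → ∀ {u} → filterOf Y ⊆ mem u → u ∈ pts Y
  filterOf⊆⇒∈ {Y} closedY {u} F⊆u = decidable-stable (lowerExcludedMiddle em) λ u∉Y →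
    let a , a∈u , φa⊆∁Y = closedY u u∉Y
    in ¬∈⇒∉ u (F⊆u (resize λ {v} v∈Y → ∉⇒¬∈ v λ a∈v → φa⊆∁Y {v} a∈v v∈Y)) a∈u

  -- Level-polymorphic, since the open and closed witnesses of the σ-extension live one level below
  -- `Powerset`, where `_∩ᴾ_` is defined.
  _∩ˢ_ : ∀ {s} → Subset s → Subset s → Subset s
  X ∩ˢ Y = record
    { pts      = pts X ∩ pts Y
    ; respects = λ u≈v (p , q) → Subset.respects X u≈v p , Subset.respects Y u≈v q
    }

  ∩-isOpen : ∀ {s} {X Y : Subset s} → IsOpen X → IsOpen Y → IsOpen (X ∩ˢ Y)
  ∩-isOpen openX openY u (u∈X , u∈Y) =
    let a , a∈u , φa⊆X = openX u u∈X
        b , b∈u , φb⊆Y = openY u u∈Y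
    in a ∧ b , Mem.∧-closed u a∈u b∈u , λ {v} a∧b∈v →
         φa⊆X {v} (Mem.≤-closed v (x∧y≤x a b) a∧b∈v) ,
         φb⊆Y {v} (Mem.≤-closed v (x∧y≤y a b) a∧b∈v)

  ∩-isClosed : {X Y : Subset (c ⊔ ℓ)} → IsClosed X → IsClosed Y → IsClosed (X ∩ˢ Y)
  ∩-isClosed {X} closedX closedY u u∉X∩Y
    -- Excluded middle decides which of the two sets `u` misses; a neighbourhood avoiding that set
    -- avoids the intersection.
    with toSum (lowerExcludedMiddle em {u ∈ pts X})
  ... | inj₁ u∈X = let a , a∈u , φa⊆∁Y = closedY u (λ u∈Y → u∉X∩Y (u∈X , u∈Y))
                   in a , a∈u , λ {v} a∈v (_ , v∈Y) → φa⊆∁Y {v} a∈v v∈Y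
  ... | inj₂ u∉X = let a , a∈u , φa⊆∁X = closedX u u∉X
                   in a , a∈u , λ {v} a∈v (v∈X , _) → φa⊆∁X {v} a∈v v∈X

  φ-isOpen : ∀ a → IsOpen (φ a)
  φ-isOpen a u a∈u = a , a∈u , id

  φ-isClosed : ∀ a → IsClosed (φ a)
  φ-isClosed a u a∉u = ¬ a , ∉⇒¬∈ u a∉u , λ {v} → ¬∈⇒∉ v

  -- An ultrafilter extending the join of the filters of `Y` and `Z` is a point of both sets, so it
  -- contains `b`. Hence `b` is in the join, and unfolding that membership yields `y` and `z`.
  compactness : ∀ {Y Z} → IsClosed Y → IsClosed Z → ∀ {b} → pts (Y ∩ˢ Z) ⊆ pts (φ b) →
                ∃₂ λ y z → pts Y ⊆ pts (φ y) × pts Z ⊆ pts (φ z) × (y ∧ z) ≤ b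
  compactness {Y} {Z} closedY closedZ Y∩Z⊆φb =
    let filY = filterOf-isFilter Y
        filZ = filterOf-isFilter Z
        y , z , y∈ , z∈ , y∧z≤b =
          ∈-allExtensions⇒∈ (⊕-isFilter filY filZ) λ u F⊆u →
            Y∩Z⊆φb {u} (filterOf⊆⇒∈ {Y} closedY {u} (F⊆u ∘ ⊕-upperˡ filY filZ) ,
                        filterOf⊆⇒∈ {Z} closedZ {u} (F⊆u ∘ ⊕-upperʳ filY filZ))
    in y , z , unresize y∈ , unresize z∈ , y∧z≤b

-- The Boolean algebra of sets of ultrafilters.

module PowersetAlgebra {c ℓ} (B : BooleanAlgebra c ℓ)
                       (em : ExcludedMiddle (suc (c ⊔ ℓ))) where
  open StoneSpace B
  private
    module P = IsDistributiveLattice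
      (UnaryAlgebra.∪-∩-isDistributiveLattice Ultrafilter (suc (c ⊔ ℓ)))

  powerset-isBooleanAlgebra : IsBooleanAlgebra _≈ᴾ_ _∪ᴾ_ _∩ᴾ_ ∁ᴾ fullᴾ emptyᴾ
  powerset-isBooleanAlgebra = isBooleanAlgebraʳ record
    { isDistributiveLattice = record
      { isLattice = record
        { isEquivalence = record { refl = ≐-refl ; sym = ≐-sym ; trans = ≐-trans }
        ; ∨-comm        = λ X Y → P.∨-comm (pts X) (pts Y)
        ; ∨-assoc       = λ X Y Z → P.∨-assoc (pts X) (pts Y) (pts Z)
        ; ∨-cong        = P.∨-cong
        ; ∧-comm        = λ X Y → P.∧-comm (pts X) (pts Y)
        ; ∧-assoc       = λ X Y Z → P.∧-assoc (pts X) (pts Y) (pts Z)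
        ; ∧-cong        = P.∧-cong
        ; absorptive    = (λ X Y → P.∨-absorbs-∧ (pts X) (pts Y)) ,
                          (λ X Y → P.∧-absorbs-∨ (pts X) (pts Y))
        }
      ; ∨-distrib-∧ = (λ X Y Z → P.∨-distribˡ-∧ (pts X) (pts Y) (pts Z)) ,
                      (λ X Y Z → P.∨-distribʳ-∧ (pts X) (pts Y) (pts Z))
      ; ∧-distrib-∨ = (λ X Y Z → P.∧-distribˡ-∨ (pts X) (pts Y) (pts Z)) ,
                      (λ X Y Z → P.∧-distribʳ-∨ (pts X) (pts Y) (pts Z))
      }
    ; ∨-complementʳ = λ X → (λ _ → tt) , (λ _ → toSum em)
    ; ∧-complementʳ = λ X → (λ (p , ¬p) → ⊥-elim (¬p p)) , λ ()
    ; ¬-cong        = λ (X⊆Y , Y⊆X) → (λ u∉X u∈Y → u∉X (Y⊆X u∈Y)) , (λ u∉Y u∈X → u∉Y (X⊆Y u∈X))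
    }

-- The conditional laws for the σ-extension.

module SigmaExtensionProperties {c ℓ} (A : ConditionalAlgebra c ℓ)
                                (em : ExcludedMiddle (suc (c ⊔ ℓ)))
                                (zorn : ZornsLemma (suc (c ⊔ ℓ)) (c ⊔ ℓ) (c ⊔ ℓ)) where
  open ConditionalAlgebra A
  open BooleanAlgebra booleanAlgebra using (refl; sym; trans)
  open BooleanOrder booleanAlgebra
  open SigmaExtension A
  open Filters booleanAlgebra
  open UltrafilterTheorem booleanAlgebra em zorn

  -- As `b ≤ b′` means `b ≈ b ∧ b′`, congruence followed by distribution over `∧` gives the claim.
  ⇒-monoʳ : ∀ a {b b′} → b ≤ b′ → (a ⇒ b) ≤ (a ⇒ b′)
  ⇒-monoʳ a b≤b′ = trans (⇒-cong refl b≤b′) (sym (⇒-∧ a _ _))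

  -- The same pair `(O , Y)` remains a witness. Congruence, one half of the meet law and the join
  -- law all reduce to this.
  ⇒σ-mono : ∀ U U′ V V′ → pts U′ ⊆ pts U → pts V ⊆ pts V′ →
            ∀ u → u ∈ pts (U ⇒σ V) → u ∈ pts (U′ ⇒σ V′)
  ⇒σ-mono _ _ _ _ U′⊆U V⊆V′ _ (O , Y , (openO , U⊆O) , (closedY , Y⊆V) , h) =
    O , Y , (openO , U⊆O ∘ U′⊆U) , (closedY , V⊆V′ ∘ Y⊆V) , h

  ⇒σ-cong : ∀ {U U′ V V′} → U ≈ᴾ U′ → V ≈ᴾ V′ → (U ⇒σ V) ≈ᴾ (U′ ⇒σ V′)
  ⇒σ-cong {U} {U′} {V} {V′} (U⊆U′ , U′⊆U) (V⊆V′ , V′⊆V) =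
    (λ {u} → ⇒σ-mono U U′ V V′ U′⊆U V⊆V′ u) , (λ {u} → ⇒σ-mono U′ U V′ V U⊆U′ V′⊆V u)

  ⇒σ-full : ∀ U → (U ⇒σ fullᴾ) ≈ᴾ fullᴾ
  ⇒σ-full U = (λ _ → tt) , λ {u} _ →
    -- The whole space serves as both `O` and `Y`. Only `b` equal to `⊤` then satisfies `Y ⊆ φ b`,
    -- and `a ⇒ ⊤` lies in every ultrafilter.
    φ ⊤ , φ ⊤ , (φ-isOpen ⊤ , λ {v} _ → Mem.⊤-mem v) , (φ-isClosed ⊤ , λ _ → tt) ,
    λ a b _ φ⊤⊆φb → Mem.≤-closed u
      (≤-trans (≤-reflexive (sym (⇒-⊤ a)))
               (⇒-monoʳ a (⊤≤ λ v → φ⊤⊆φb {v} (Mem.⊤-mem v))))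
      (Mem.⊤-mem u)

  ⇒σ-∩ : ∀ U V W → ((U ⇒σ V) ∩ᴾ (U ⇒σ W)) ≈ᴾ (U ⇒σ (V ∩ᴾ W))
  ⇒σ-∩ U V W = (λ {u} → to u) , λ {u} p →
    ⇒σ-mono U U (V ∩ᴾ W) V id proj₁ u p , ⇒σ-mono U U (V ∩ᴾ W) W id proj₂ u p
    where
    to : ∀ u → u ∈ pts ((U ⇒σ V) ∩ᴾ (U ⇒σ W)) → u ∈ pts (U ⇒σ (V ∩ᴾ W))
    to u ((O₁ , Y₁ , (open₁ , U⊆O₁) , (closed₁ , Y₁⊆V) , h₁) ,
            (O₂ , Y₂ , (open₂ , U⊆O₂) , (closed₂ , Y₂⊆W) , h₂)) =
      O₁ ∩ˢ O₂ , Y₁ ∩ˢ Y₂ ,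
      (∩-isOpen {X = O₁} {O₂} open₁ open₂ , λ u∈U → U⊆O₁ u∈U , U⊆O₂ u∈U) ,
      (∩-isClosed {Y₁} {Y₂} closed₁ closed₂ , λ (p , q) → Y₁⊆V p , Y₂⊆W q) ,
      λ a b φa⊆O Y⊆φb →
        let b₁ , b₂ , Y₁⊆φb₁ , Y₂⊆φb₂ , b₁∧b₂≤b =
              compactness {Y₁} {Y₂} closed₁ closed₂ {b} Y⊆φb
        in Mem.≤-closed u
             (≤-trans (≤-reflexive (⇒-∧ a b₁ b₂)) (⇒-monoʳ a b₁∧b₂≤b))
             (Mem.∧-closed u
               -- Since `φ a` lies inside `O₁ ∩ O₂`, the antecedent `a` is admissible for both
               -- witnesses.
               (h₁ a b₁ (λ {v} → proj₁ ∘ φa⊆O {v}) (λ {v} → Y₁⊆φb₁ {v}))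
               (h₂ a b₂ (λ {v} → proj₂ ∘ φa⊆O {v}) (λ {v} → Y₂⊆φb₂ {v})))

  ∪-⇒σ : ∀ U V W u → u ∈ pts ((U ∪ᴾ V) ⇒σ W) → u ∈ pts ((U ⇒σ W) ∩ᴾ (V ⇒σ W))
  ∪-⇒σ U V W u p =
    ⇒σ-mono (U ∪ᴾ V) U W W inj₁ id u p , ⇒σ-mono (U ∪ᴾ V) V W W inj₂ id u p

theorem2p15 : ∀ {c ℓ : Level} →
    ExcludedMiddle (suc (c ⊔ ℓ)) →
    ZornsLemma (suc (c ⊔ ℓ)) (c ⊔ ℓ) (c ⊔ ℓ) →
    (A : ConditionalAlgebra c ℓ) →
    let open SigmaExtension A in
    IsConditionalAlgebra _≈ᴾ_ _∪ᴾ_ _∩ᴾ_ ∁ᴾ fullᴾ emptyᴾ _⇒σ_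
theorem2p15 em zorn A = record
  { isBooleanAlgebra = powerset-isBooleanAlgebra
  ; ⇒-cong           = λ {U} {U′} {V} {V′} → ⇒σ-cong {U} {U′} {V} {V′}
  ; ⇒-⊤              = ⇒σ-full
  ; ⇒-∧              = ⇒σ-∩
  -- The natural order unfolds to `X ≈ X ∩ Y`, so the inclusion is paired with a projection for the
  -- converse.
  ; ∨-⇒              = λ U V W → (λ {u} p → p , ∪-⇒σ U V W u p) , proj₁
  }
  where
  open SigmaExtensionProperties A em zorn
  open PowersetAlgebra (ConditionalAlgebra.booleanAlgebra A) em
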